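{- Let $\mathbf{a}$ be a weak composition. Then $\mathcal{P}(\mathbb{D}(\mathbf{a}))$ is ranked if and only if $\mathbf{a}$ is pure.
   Context: A diagram is a finite set $D$ of cells $(r,c)$ with $r,c$ positive integers; $r$ is the row (rows numbered from bottom to top starting at 1) and $c$ the column (numbered from left to right starting at 1). A Kohnert move at row $r$ applied to a diagram $D$: if row $r$ of $D$ is empty, $D$ is unchanged; otherwise let $(r,c)$ be the cell of row $r$ with the largest column index; if every position $(r',c)$ with $1\le r'<r$ belongs to $D$, then $D$ is unchanged; otherwise let $r'$ be the largest integer with $1\le r'<r$ and $(r',c)\notin D$, and the move replaces the cell $(r,c)$ by $(r',c)$. For a diagram $D_0$, $KD(D_0)$ is the set of all diagrams obtainable from $D_0$ by finite (possibly empty) sequences of Kohnert moves; the Kohnert poset $\mathcal{P}(D_0)$ is $KD(D_0)$ ordered by $D_2\preceq D_1$ iff $D_2$ can be obtained from $D_1$ by a finite sequence of Kohnert moves. A finite poset $P$ is ranked if there is a function $\rho:P\to\mathbb{Z}_{\ge0}$ such that $x\prec y$ implies $\rho(x)<\rho(y)$ and $\rho(y)=\rho(x)+1$ whenever $y$ covers $x$. For a weak composition $\mathbf{a}=(a_1,\dots,a_n)\in\mathbb{Z}_{\ge0}^n$, the key diagram is $\mathbb{D}(\mathbf{a})=\bigcup_{i=1}^n\{(i,j):1\le j\le a_i\}$. The weak composition $\mathbf{a}$ is pure if there are no indices $1\le j_1<j_2<j_3\le n$ with $a_{j_1}<a_{j_2}<a_{j_3}$, or $a_{j_1}<a_{j_3}<a_{j_2}$,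 or $a_{j_1}+1<a_{j_2}=a_{j_3}$. -}

module Defs where

open import Data.Nat using (ℕ; zero; suc; pred; _⊔_; _<_; _≡ᵇ_)
open import Data.Nat.Properties using ()
open import Data.Bool using (Bool; true; false; if_then_else_; _∧_; not)
open import Data.Product using (Σ; ∃; _×_; _,_; proj₁; proj₂)
open import Data.Maybe using (Maybe; just; nothing)
open import Data.List using (List; []; _∷_; filter; length; lookup; concatMap; map; upTo; foldr)
open import Data.Bool.ListAction using (any)
open import Data.Fin as Fin using (Fin)
open import Relation.Binary.PropositionalEquality using (_≡_)
open import Relation.Binary.Construct.Closure.ReflexiveTransitive using (Star)
open import Relation.Nullary using (¬_)
open import Data.Sum using (_⊎_)

-- A cell (r , c): r = row (bottom to top, from 1), c = column (from 1).
Cell : Set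
Cell = ℕ × ℕ

-- A diagram is a finite set of cells, represented by a list of cells
-- (a list denotes the set of its members; order/duplicates irrelevant).
Diagram : Set
Diagram = List Cell

_==ᶜ_ : Cell → Cell → Bool
(r , c) ==ᶜ (r' , c') = (r ≡ᵇ r') ∧ (c ≡ᵇ c')

_∈ᵇ_ : Cell → Diagram → Bool
x ∈ᵇ D = any (x ==ᶜ_) D

_≐_ : Diagram → Diagram → Set
D ≐ E = ∀ x → x ∈ᵇ D ≡ x ∈ᵇ E

rowMax : ℕ → Diagram → Maybe ℕ
rowMax r [] = nothing
rowMax r ((r' , c') ∷ D) with rowMax r D | r ≡ᵇ r'
... | m        | false = m
... | nothing  | true  = just c'
... | just m   | true  = just (m ⊔ c')

freeBelow : ℕ → Diagram → ℕ → Maybe ℕ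
freeBelow c D zero    = nothing
freeBelow c D (suc k) = if (suc k , c) ∈ᵇ D then freeBelow c D k else just (suc k)

removeCell : Cell → Diagram → Diagram
removeCell x [] = []
removeCell x (y ∷ D) = if x ==ᶜ y then removeCell x D else y ∷ removeCell x D

kohnert : ℕ → Diagram → Diagram
kohnert r D with rowMax r D
... | nothing = D
... | just c with freeBelow c D (pred r)
...   | nothing = D
...   | just r' = (r' , c) ∷ removeCell (r , c) D

KStep : Diagram → Diagram → Set
KStep D E = ∃ λ r → E ≡ kohnert r D

_⪯_ : Diagram → Diagram → Set
E ⪯ D = ∃ λ E' → Star KStep D E' × (E' ≐ E)

InKD : Diagram → Diagram → Set
InKD D₀ D = D ⪯ D₀

_≺_ : Diagram → Diagram → Set
x ≺ y = (x ⪯ y) × ¬ (x ≐ y)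

-- y covers x in P(D₀) (any z with x ≺ z ≺ y automatically lies in KD(D₀))
Covers : Diagram → Diagram → Set
Covers y x = (x ≺ y) × ¬ (∃ λ z → (x ≺ z) × (z ≺ y))

Ranked : Diagram → Set
Ranked D₀ = Σ (Diagram → ℕ) λ ρ →
    (∀ x y → InKD D₀ x → InKD D₀ y → x ≐ y → ρ x ≡ ρ y)
  × (∀ x y → InKD D₀ x → InKD D₀ y → x ≺ y → ρ x < ρ y)
  × (∀ x y → InKD D₀ x → InKD D₀ y → Covers y x → ρ y ≡ suc (ρ x))

-- a weak composition (a₁,…,aₙ) is a list of naturals; aᵢ is the entry at
-- 0-based position i-1
WeakComp : Set
WeakComp = List ℕ

keyRows : ℕ → List ℕ → Diagram
keyRows i [] = []
keyRows i (aᵢ ∷ a) = map (λ j → (i , suc j)) (upTo aᵢ) Data.List.++ keyRows (suc i) a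

keyDiagram : WeakComp → Diagram
keyDiagram a = keyRows 1 a

Pure : WeakComp → Set
Pure a = ∀ (j₁ j₂ j₃ : Fin (length a)) → j₁ Fin.< j₂ → j₂ Fin.< j₃ →
  let x = lookup a j₁ ; y = lookup a j₂ ; z = lookup a j₃ in
  ¬ ((x < y × y < z) ⊎ (x < z × z < y) ⊎ (suc x < y × y ≡ z))

module Submission where

open import Defs
open import Function.Bundles using (_⇔_; mk⇔; Equivalence)
open import Algebra.Properties.CommutativeSemigroup using (xy∙z≈xz∙y)
open import Data.Bool using (Bool; true; false; if_then_else_; _∧_; _∨_)
open import Data.Bool.Properties using (T-≡; ⇔→≡; ¬-not; ∨-identityʳ)
open import Data.Empty using (⊥)
open import Data.Fin using (Fin; toℕ; fromℕ<)
open import Data.Fin.Properties using (toℕ-fromℕ<)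
open import Data.List using (List; []; _∷_; length; lookup; map; upTo)
open import Data.List.Membership.Propositional using (_∈_)
open import Data.List.Membership.Propositional.Properties
  using (∈-map⁺; ∈-map⁻; ∈-++⁺ˡ; ∈-++⁺ʳ; ∈-++⁻; ∈-upTo⁺; ∈-upTo⁻)
import Data.List.Relation.Unary.Any as Any
open import Data.List.Relation.Unary.Any.Properties using (any⁺; any⁻)
open import Data.Maybe using (Maybe; just; nothing)
open import Data.Nat
open import Data.Nat.Properties
open import Data.Nat.Solver using (module +-*-Solver)
open import Data.Product using (∃; ∃₂; _×_; _,_; proj₁; proj₂)
open import Data.Product.Properties using (×-≡,≡→≡; ×-≡,≡←≡)
open import Data.Sum using (_⊎_; inj₁; inj₂)
open import Data.Unit using (⊤; tt)
open import Function using (_∘_)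
open import Relation.Binary.Construct.Closure.ReflexiveTransitive using (Star; ε; _◅_)
open import Relation.Binary.Definitions using (Tri; tri<; tri≈; tri>)
open import Relation.Binary.PropositionalEquality
open import Relation.Nullary using (¬_; Dec; yes; no; contradiction)
open import Relation.Nullary.Decidable using (dec-true; dec-false; map′; _×-dec_)

-- The candidate rank of a diagram is the sum of the rows of its cells: every move lowers it, and
-- a move by a single row is always a cover.
--
-- If a is pure and a move jumps over some rows, then no cell lies to the right of the moved column
-- in the skipped rows: such a cell, the two cells of that column and the vacant position would come
-- from three entries of a forming a forbidden pattern. So the lowest skipped cell could have been
-- moved first, and only moves by a single row are covers.
--
-- If a is not pure, exchanging an ascent of adjacent entries, which moves cells by one row each,
-- brings a forbidden pattern x, y, z to adjacent rows. There the cell of column x + 1 can jump from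
-- the third row to the first while a cell to its right pins the middle row. This is a cover that
-- lowers the row sum by 2, although its effect is also part of a sequence of moves by one row.

-- Configurations, moves and paths

Config : Set
Config = Cell → Bool

-- Order and repetition in the list disappear here, so `D ≐ E` is literally `⟦ D ⟧ ≗ ⟦ E ⟧`.
⟦_⟧ : Diagram → Config
⟦ D ⟧ x = x ∈ᵇ D

≗-sym : {f g : Config} → f ≗ g → g ≗ f
≗-sym f≗g x = sym (f≗g x)

≗-trans : {f g h : Config} → f ≗ g → g ≗ h → f ≗ h
≗-trans f≗g g≗h x = trans (f≗g x) (g≗h x)

true≢false : {b : Bool} → b ≡ true → b ≡ false → ⊥
true≢false p q with trans (sym p) q
... | ()

_≟ᶜ_ : (x y : Cell) → Dec (x ≡ y)
(r , c) ≟ᶜ (r′ , c′) = map′ ×-≡,≡→≡ ×-≡,≡←≡ (r ≟ r′ ×-dec c ≟ c′)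

==ᶜ-refl : ∀ x → (x ==ᶜ x) ≡ true
==ᶜ-refl x = dec-true (x ≟ᶜ x) refl

==ᶜ-≢ : ∀ {x y} → x ≢ y → (x ==ᶜ y) ≡ false
==ᶜ-≢ {x} {y} = dec-false (x ≟ᶜ y)

==ᶜ⇒≡ : ∀ x y → (x ==ᶜ y) ≡ true → x ≡ y
==ᶜ⇒≡ x y p with x ≟ᶜ y
... | yes x≡y = x≡y
... | no x≢y = contradiction (==ᶜ-≢ x≢y) (true≢false p)

slide : Cell → Cell → Config → Config
slide p q f x = if x ==ᶜ q then true else (if x ==ᶜ p then false else f x)

slide-target : ∀ p q f → slide p q f q ≡ true
slide-target p q f rewrite ==ᶜ-refl q = refl

slide-source : ∀ {p q} f → p ≢ q → slide p q f p ≡ false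
slide-source {p} f p≢q rewrite ==ᶜ-≢ p≢q | ==ᶜ-refl p = refl

slide-other : ∀ {p q} f {x} → x ≢ p → x ≢ q → slide p q f x ≡ f x
slide-other f x≢p x≢q rewrite ==ᶜ-≢ x≢q | ==ᶜ-≢ x≢p = refl

slide-cong : ∀ p q {f g} → f ≗ g → slide p q f ≗ slide p q g
slide-cong p q f≗g x rewrite f≗g x = refl

slide⁻ : ∀ p q f x → slide p q f x ≡ true → x ≡ q ⊎ (x ≢ p × f x ≡ true)
slide⁻ p q f x fx with x ≟ᶜ q | x ≟ᶜ p
... | yes x≡q | _        = inj₁ x≡q
... | no x≢q  | yes refl = contradiction (slide-source f x≢q) (true≢false fx)
... | no x≢q  | no x≢p   = inj₂ (x≢p , trans (sym (slide-other f x≢p x≢q)) fx)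

-- `KStep` also allows idle steps, but a `Move` always brings a cell down, which is what makes the
-- row sum strictly decrease. `effect` is pointwise because configurations are functions.
record Move (f g : Config) : Set where
  field
    top bot col : ℕ
    0<bot     : 0 < bot
    bot<top   : bot < top
    occupied  : f (top , col) ≡ true
    rightmost : ∀ {c} → col < c → f (top , c) ≡ false
    vacant    : f (bot , col) ≡ false
    full      : ∀ {s} → bot < s → s < top → f (s , col) ≡ true
    effect    : g ≗ slide (top , col) (bot , col) f

open Move

-- `P` constrains the rows of each move, so arbitrary paths and paths of unit moves share one type.
-- `done` absorbs a pointwise equality, which lets endpoints be exchanged for equal ones.
data Path (P : ℕ → ℕ → Set) (f g : Config) : Set where
  done : f ≗ g → Path P f g
  step : ∀ {h} (m : Move f h) → P (top m) (bot m) → Path P h g → Path P f g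

Reach : Config → Config → Set
Reach = Path λ _ _ → ⊤

UnitPath : Config → Config → Set
UnitPath = Path λ t b → t ≡ suc b

move-respˡ : ∀ {f f′ g} → f ≗ f′ → Move f g → Move f′ g
move-respˡ e m = record
  { Move m
  ; occupied  = trans (sym (e _)) (occupied m)
  ; rightmost = λ c → trans (sym (e _)) (rightmost m c)
  ; vacant    = trans (sym (e _)) (vacant m)
  ; full      = λ p q → trans (sym (e _)) (full m p q)
  ; effect    = ≗-trans (effect m) (slide-cong _ _ e)
  }

move-respʳ : ∀ {f g g′} → g ≗ g′ → Move f g → Move f g′
move-respʳ e m = record { Move m ; effect = ≗-trans (≗-sym e) (effect m) }

path-respˡ : ∀ {P f f′ g} → f ≗ f′ → Path P f g → Path P f′ g
path-respˡ e (done f≗g)   = done (≗-trans (≗-sym e) f≗g)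
path-respˡ e (step m p π) = step (move-respˡ e m) p π

path-trans : ∀ {P f g h} → Path P f g → Path P g h → Path P f h
path-trans (done f≗g)   ρ = path-respˡ (≗-sym f≗g) ρ
path-trans (step m p π) ρ = step m p (path-trans π ρ)

-- Kohnert moves on lists versus moves on configurations

data RowMax (r : ℕ) (D : Diagram) : Maybe ℕ → Set where
  empty-row : (∀ c → ⟦ D ⟧ (r , c) ≡ false) → RowMax r D nothing
  max-at    : ∀ {c} → ⟦ D ⟧ (r , c) ≡ true → (∀ {c′} → c < c′ → ⟦ D ⟧ (r , c′) ≡ false) →
              RowMax r D (just c)

∨-false : ∀ {a b} → a ≡ false → b ≡ false → a ∨ b ≡ false
∨-false refl refl = refl

∨-trueˡ : ∀ {a b} → a ≡ true → a ∨ b ≡ true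
∨-trueˡ refl = refl

∨-trueʳ : ∀ {a b} → b ≡ true → a ∨ b ≡ true
∨-trueʳ {true}  refl = refl
∨-trueʳ {false} refl = refl

rowMax-spec : ∀ r D → RowMax r D (rowMax r D)
rowMax-spec r [] = empty-row λ _ → refl
rowMax-spec r ((r′ , c′) ∷ D) with rowMax r D | rowMax-spec r D | r ≡ᵇ r′ in eq
... | nothing | empty-row e | false = empty-row λ c → ∨-false (cong (_∧ (c ≡ᵇ c′)) eq) (e c)
... | just m  | max-at o e  | false = max-at (∨-trueʳ o) λ {c} m<c → ∨-false (cong (_∧ (c ≡ᵇ c′)) eq) (e m<c)
... | nothing | empty-row e | true  = max-at
  (∨-trueˡ (cong₂ _∧_ eq (dec-true (c′ ≟ c′) refl)))
  λ {c} c′<c → ∨-false (cong₂ _∧_ eq (dec-false (c ≟ c′) (>⇒≢ c′<c))) (e c)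
... | just m  | max-at o e  | true  with ≤-total m c′
... | inj₁ m≤c′ rewrite m≤n⇒m⊔n≡n m≤c′ = max-at
  (∨-trueˡ (cong₂ _∧_ eq (dec-true (c′ ≟ c′) refl)))
  λ {c} c′<c → ∨-false (cong₂ _∧_ eq (dec-false (c ≟ c′) (>⇒≢ c′<c))) (e (≤-<-trans m≤c′ c′<c))
... | inj₂ c′≤m rewrite m≥n⇒m⊔n≡m c′≤m = max-at
  (∨-trueʳ o)
  λ {c} m<c → ∨-false (cong₂ _∧_ eq (dec-false (c ≟ c′) (>⇒≢ (≤-<-trans c′≤m m<c)))) (e m<c)

data FreeBelow (c : ℕ) (D : Diagram) (k : ℕ) : Maybe ℕ → Set where
  column-full : (∀ {s} → 0 < s → s ≤ k → ⟦ D ⟧ (s , c) ≡ true) → FreeBelow c D k nothing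
  free-at     : ∀ {b} → 0 < b → b ≤ k → ⟦ D ⟧ (b , c) ≡ false →
                (∀ {s} → b < s → s ≤ k → ⟦ D ⟧ (s , c) ≡ true) → FreeBelow c D k (just b)

freeBelow-spec : ∀ c D k → FreeBelow c D k (freeBelow c D k)
freeBelow-spec c D zero = column-full λ 0<s s≤0 → contradiction s≤0 (<⇒≱ 0<s)
freeBelow-spec c D (suc k) with (suc k , c) ∈ᵇ D in eq
... | false = free-at z<s ≤-refl eq λ p q → contradiction q (<⇒≱ p)
... | true  with freeBelow c D k | freeBelow-spec c D k
... | nothing | column-full e = column-full λ 0<s s≤1+k → extend e 0<s (m≤n⇒m<n∨m≡n s≤1+k)
  where
  extend : (∀ {s} → 0 < s → s ≤ k → ⟦ D ⟧ (s , c) ≡ true) →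
           ∀ {s} → 0 < s → s < suc k ⊎ s ≡ suc k → ⟦ D ⟧ (s , c) ≡ true
  extend e 0<s (inj₁ s<1+k) = e 0<s (s≤s⁻¹ s<1+k)
  extend e 0<s (inj₂ refl)  = eq
... | just b | free-at 0<b b≤k v e = free-at 0<b (m≤n⇒m≤1+n b≤k) v
  λ b<s s≤1+k → extend b<s (m≤n⇒m<n∨m≡n s≤1+k)
  where
  extend : ∀ {s} → b < s → s < suc k ⊎ s ≡ suc k → ⟦ D ⟧ (s , c) ≡ true
  extend b<s (inj₁ s<1+k) = e b<s (s≤s⁻¹ s<1+k)
  extend b<s (inj₂ refl)  = eq

removeCell-self : ∀ p D → p ∈ᵇ removeCell p D ≡ false
removeCell-self p [] = refl
removeCell-self p (y ∷ D) with p ==ᶜ y in eq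
... | true  = removeCell-self p D
... | false = ∨-false eq (removeCell-self p D)

removeCell-other : ∀ {p x} D → x ≢ p → x ∈ᵇ removeCell p D ≡ x ∈ᵇ D
removeCell-other [] x≢p = refl
removeCell-other {p} {x} (y ∷ D) x≢p with p ==ᶜ y in eq
... | false = cong ((x ==ᶜ y) ∨_) (removeCell-other D x≢p)
... | true with ==ᶜ⇒≡ p y eq
... | refl rewrite ==ᶜ-≢ x≢p = removeCell-other D x≢p

replace-slide : ∀ p q D → ⟦ q ∷ removeCell p D ⟧ ≗ slide p q ⟦ D ⟧
replace-slide p q D x with x ==ᶜ q
... | true = refl
... | false with x ≟ᶜ p
... | yes refl rewrite ==ᶜ-refl x = removeCell-self x D
... | no x≢p rewrite ==ᶜ-≢ x≢p = removeCell-other D x≢p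

kohnert-move : ∀ r D → kohnert r D ≡ D ⊎ Move ⟦ D ⟧ ⟦ kohnert r D ⟧
kohnert-move r D with rowMax r D | rowMax-spec r D
... | nothing | _ = inj₁ refl
... | just c | max-at o e with freeBelow c D (pred r) | freeBelow-spec c D (pred r)
... | nothing | _ = inj₁ refl
... | just b | free-at 0<b b≤ v full = inj₂ record
  { top = r ; bot = b ; col = c ; 0<bot = 0<b
  ; bot<top = <-≤-trans (s≤s b≤) (≤-reflexive suc-r)
  ; occupied = o ; rightmost = e ; vacant = v
  ; full = λ b<s s<r → full b<s (<⇒≤pred s<r)
  ; effect = replace-slide (r , c) (b , c) D }
  where
  -- The search starts at `pred r`, which would be wrong only for row 0; this is excluded by
  -- `0 < b ≤ pred r`.
  suc-r : suc (pred r) ≡ r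
  suc-r = suc-pred r ⦃ >-nonZero (<-≤-trans 0<b (≤-trans b≤ pred[n]≤n)) ⦄

-- A row determines its move: the rightmost cell and the highest vacancy below it are unique, so
-- comparing what `kohnert` finds with the data of `m` rules out every inequality.
move-kohnert : ∀ D {g} → (m : Move ⟦ D ⟧ g) → ⟦ kohnert (top m) D ⟧ ≗ g
move-kohnert D m with rowMax (top m) D | rowMax-spec (top m) D
... | nothing | empty-row e = contradiction (e (col m)) (true≢false (occupied m))
... | just c | max-at o e with <-cmp c (col m)
... | tri< c<col _ _ = contradiction (e c<col) (true≢false (occupied m))
... | tri> _ _ c>col = contradiction (rightmost m c>col) (true≢false o)
... | tri≈ _ refl _ with freeBelow c D (pred (top m)) | freeBelow-spec c D (pred (top m))
... | nothing | column-full e′ = contradiction (vacant m) (true≢false (e′ (0<bot m) (<⇒≤pred (bot<top m))))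
... | just b | free-at 0<b b≤ v e′ with <-cmp b (bot m)
... | tri< b<bot _ _ = contradiction (vacant m) (true≢false (e′ b<bot (<⇒≤pred (bot<top m))))
... | tri> _ _ b>bot = contradiction v (true≢false (full m b>bot
        (<-≤-trans (s≤s b≤) (≤-reflexive (suc-pred (top m) ⦃ >-nonZero (m<n⇒0<n (bot<top m)) ⦄)))))
... | tri≈ _ refl _ = ≗-trans (replace-slide _ _ D) (≗-sym (effect m))

star⇒reach : ∀ {D E} → Star KStep D E → Reach ⟦ D ⟧ ⟦ E ⟧
star⇒reach ε = done λ _ → refl
star⇒reach {D} ((r , refl) ◅ s) with kohnert-move r D
... | inj₁ e = path-respˡ (λ x → cong (x ∈ᵇ_) e) (star⇒reach s)
... | inj₂ m = step m tt (star⇒reach s)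

⪯⇒reach : ∀ D E → E ⪯ D → Reach ⟦ D ⟧ ⟦ E ⟧
⪯⇒reach D E (E′ , s , e) = path-trans (star⇒reach s) (done e)

-- The configurations along a path are bare functions. Replaying the moves with `kohnert` supplies
-- the lists that the order on diagrams speaks of.
realise : ∀ {f g} D → ⟦ D ⟧ ≗ f → Reach f g → ∃ λ E → Star KStep D E × ⟦ E ⟧ ≗ g
realise D e (done f≗g) = D , ε , ≗-trans e f≗g
realise D e (step m _ π) with move-respˡ (≗-sym e) m
... | m′ with realise (kohnert (top m′) D) (move-kohnert D m′) π
... | E , s , e′ = E , (top m′ , refl) ◅ s , e′

reach⇒⪯ : ∀ {D E} → Reach ⟦ D ⟧ ⟦ E ⟧ → E ⪯ D
reach⇒⪯ {D} = realise D λ _ → refl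

⪯-trans : ∀ {D E F} → F ⪯ E → E ⪯ D → F ⪯ D
⪯-trans {D} {E} {F} p q = reach⇒⪯ {D} {F} (path-trans (⪯⇒reach D E q) (⪯⇒reach E F p))

-- The row sum of a configuration

sumBelow : ℕ → (ℕ → ℕ) → ℕ
sumBelow zero    f = 0
sumBelow (suc n) f = f n + sumBelow n f

sum-cong : ∀ n {f g} → (∀ {i} → i < n → f i ≡ g i) → sumBelow n f ≡ sumBelow n g
sum-cong zero    e = refl
sum-cong (suc n) e = cong₂ _+_ (e ≤-refl) (sum-cong n (e ∘ m<n⇒m<1+n))

-- The corrections `a` and `b` stand on opposite sides, so that a summand may grow or shrink without
-- truncated subtraction.
sum-change : ∀ n {f g k a b} → k < n → (∀ {i} → i ≢ k → f i ≡ g i) →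
             f k + a ≡ g k + b → sumBelow n f + a ≡ sumBelow n g + b
sum-change (suc n) {f} {g} {k} {a} {b} k<1+n same at-k with k ≟ n
... | yes refl = begin
  f n + sumBelow n f + a ≡⟨ xy∙z≈xz∙y +-commutativeSemigroup (f n) _ a ⟩
  f n + a + sumBelow n f ≡⟨ cong₂ _+_ at-k (sum-cong n (same ∘ <⇒≢)) ⟩
  g n + b + sumBelow n g ≡⟨ xy∙z≈xz∙y +-commutativeSemigroup (g n) b _ ⟩
  g n + sumBelow n g + b ∎
  where open ≡-Reasoning
... | no k≢n = begin
  f n + sumBelow n f + a   ≡⟨ +-assoc (f n) _ a ⟩
  f n + (sumBelow n f + a) ≡⟨ cong₂ _+_ (same (k≢n ∘ sym)) (sum-change n (≤∧≢⇒< (s≤s⁻¹ k<1+n) k≢n) same at-k) ⟩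
  g n + (sumBelow n g + b) ≡⟨ +-assoc (g n) _ b ⟨
  g n + sumBelow n g + b   ∎
  where open ≡-Reasoning

weight : ℕ → Bool → ℕ
weight r b = if b then r else 0

columnSum : ℕ → Config → ℕ → ℕ
columnSum N f c = sumBelow N λ r → weight r (f (r , c))

-- Summing over a box instead of the list makes the value independent of repeated entries. It is the
-- full row sum as soon as `Bounded N f` holds.
height : ℕ → Config → ℕ
height N f = sumBelow N (columnSum N f)

height-cong : ∀ N {f g} → f ≗ g → height N f ≡ height N g
height-cong N e = sum-cong N λ {c} _ → sum-cong N λ {r} _ → cong (weight r) (e (r , c))

Bounded : ℕ → Config → Set
Bounded N f = ∀ r c → f (r , c) ≡ true → r < N × c < N

bounded : ∀ D → ∃ λ N → Bounded N ⟦ D ⟧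
bounded [] = 0 , λ _ _ ()
bounded ((r , c) ∷ D) with bounded D
... | N , bound = suc (r + c + N) , bound′
  where
  bound′ : Bounded (suc (r + c + N)) ⟦ (r , c) ∷ D ⟧
  bound′ s d e with (s , d) ==ᶜ (r , c) in eq
  ... | false = let s<N , d<N = bound s d e in
                m≤n⇒m≤1+n (≤-trans s<N (m≤n+m N (r + c))) , m≤n⇒m≤1+n (≤-trans d<N (m≤n+m N (r + c)))
  ... | true with ==ᶜ⇒≡ (s , d) (r , c) eq
  ... | refl = s≤s (≤-trans (m≤m+n r c) (m≤m+n (r + c) N)) , s≤s (≤-trans (m≤n+m c r) (m≤m+n (r + c) N))

bounded-resp : ∀ {N f g} → f ≗ g → Bounded N f → Bounded N g
bounded-resp e bound r c o = bound r c (trans (e _) o)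

column≢ : ∀ {r s c d : ℕ} → c ≢ d → (r , c) ≢ (s , d)
column≢ c≢d refl = c≢d refl

row≢ : ∀ {r s c d : ℕ} → r ≢ s → (r , c) ≢ (s , d)
row≢ r≢s refl = r≢s refl

move-column : ∀ {f g} (m : Move f g) r {c} → c ≢ col m → g (r , c) ≡ f (r , c)
move-column {f} m r {c} c≢k = trans (effect m (r , c)) (slide-other f (column≢ c≢k) (column≢ c≢k))

bounded-move : ∀ {N f g} → Bounded N f → Move f g → Bounded N g
bounded-move {f = f} bound m r c o with slide⁻ _ _ f (r , c) (trans (sym (effect m (r , c))) o)
... | inj₂ (_ , o′) = bound r c o′
... | inj₁ refl = let top<N , col<N = bound _ _ (occupied m) in <-trans (bot<top m) top<N , col<N

height-move : ∀ {N f g} → Bounded N f → (m : Move f g) → height N f + bot m ≡ height N g + top m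
height-move {N} {f} {g} bound m = sum-change N (proj₂ in-box) elsewhere changed
  where
  t b k : ℕ
  t = top m
  b = bot m
  k = col m

  b≢t : b ≢ t
  b≢t = <⇒≢ (bot<top m)

  in-box : t < N × k < N
  in-box = bound t k (occupied m)

  elsewhere : ∀ {c} → c ≢ k → columnSum N f c ≡ columnSum N g c
  elsewhere c≢k = sum-cong N λ {r} _ → cong (weight r)(sym (move-column m r c≢k))

  -- The intermediate column has lost its top cell and not yet gained the bottom one, so `erase` and
  -- `insert` each alter a single summand.
  erased : ℕ → ℕ
  erased r = weight r (if r ≡ᵇ t then false else f (r , k))

  erase : columnSum N f k + 0 ≡ sumBelow N erased + t
  erase = sum-change N (proj₁ in-box)
    (λ {r} r≢t → cong (λ e → weight r (if e then false else f (r , k))) (sym (dec-false (r ≟ t) r≢t)))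
    at-top
    where
    at-top : weight t (f (t , k)) + 0 ≡ erased t + t
    at-top rewrite occupied m | dec-true (t ≟ t) refl = +-identityʳ t

  insert : sumBelow N erased + b ≡ columnSum N g k + 0
  insert = sum-change N (<-trans (bot<top m) (proj₁ in-box)) away at-bot
    where
    away : ∀ {r} → r ≢ b → erased r ≡ weight r (g (r , k))
    away {r} r≢b with r ≟ t
    ... | yes refl rewrite dec-true (t ≟ t) refl | trans (effect m (t , k)) (slide-source f (row≢ r≢b)) = refl
    ... | no r≢t rewrite dec-false (r ≟ t) r≢t | trans (effect m (r , k)) (slide-other f (row≢ r≢t) (row≢ r≢b)) = refl

    at-bot : erased b + b ≡ weight b (g (b , k)) + 0
    at-bot rewrite dec-false (b ≟ t) b≢t | vacant m | trans (effect m (b , k)) (slide-target (t , k) (b , k) f) =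
      sym (+-identityʳ b)

  changed : columnSum N f k + b ≡ columnSum N g k + t
  changed = begin
    columnSum N f k + b     ≡⟨ cong (_+ b) (trans (sym (+-identityʳ _)) erase) ⟩
    sumBelow N erased + t + b ≡⟨ xy∙z≈xz∙y +-commutativeSemigroup (sumBelow N erased) t b ⟩
    sumBelow N erased + b + t ≡⟨ cong (_+ t) (trans insert (+-identityʳ _)) ⟩
    columnSum N g k + t     ∎
    where open ≡-Reasoning

height-move-< : ∀ {N f g} → Bounded N f → Move f g → height N g < height N f
height-move-< {N} {f} {g} bound m = +-cancelʳ-< (bot m) _ _ (begin-strict
  height N g + bot m <⟨ +-monoʳ-< (height N g) (bot<top m) ⟩
  height N g + top m ≡⟨ height-move bound m ⟨
  height N f + bot m ∎)
  where open ≤-Reasoning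

height-reach : ∀ {N f g} → Bounded N f → Reach f g → height N g ≤ height N f
height-reach {N} bound (done e)     = ≤-reflexive (sym (height-cong N e))
height-reach     bound (step m _ π) =
  ≤-trans (height-reach (bounded-move bound m) π) (<⇒≤ (height-move-< bound m))

-- Any move on the path would strictly lower the height, so only the empty path remains.
reach-level : ∀ {N f g} → Bounded N f → Reach f g → height N f ≤ height N g → f ≗ g
reach-level bound (done e)     _ = e
reach-level bound (step m _ π) f≤g = contradiction f≤g
  (<⇒≱ (≤-<-trans (height-reach (bounded-move bound m) π) (height-move-< bound m)))

bounded-reach : ∀ {N f g} → Bounded N f → Reach f g → Bounded N g
bounded-reach bound (done e)     = bounded-resp e bound
bounded-reach bound (step m _ π) = bounded-reach (bounded-move bound m) π

height-drop : ∀ {N f g} → Bounded N f → (m : Move f g) → ∀ d → top m ≡ d + bot m → height N f ≡ d + height N g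
height-drop {N} {f} {g} bound m d e = +-cancelʳ-≡ (bot m) _ _ (begin
  height N f + bot m       ≡⟨ height-move bound m ⟩
  height N g + top m       ≡⟨ cong (height N g +_) e ⟩
  height N g + (d + bot m) ≡⟨ +-assoc (height N g) d _ ⟨
  height N g + d + bot m   ≡⟨ cong (_+ bot m) (+-comm (height N g) d) ⟩
  d + height N g + bot m   ∎)
  where open ≡-Reasoning

-- The strict order and covers

≺-move : ∀ D E → E ≺ D → ∃ λ h → Move ⟦ D ⟧ h × Reach h ⟦ E ⟧
≺-move D E (E⪯D , E≭D) with ⪯⇒reach D E E⪯D
... | done e     = contradiction (≗-sym e) E≭D
... | step m _ π = _ , m , π

move-≺ : ∀ {N} D E {h} → Bounded N ⟦ D ⟧ → Move ⟦ D ⟧ h → Reach h ⟦ E ⟧ → E ≺ D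
move-≺ {N} D E bound m π = reach⇒⪯ {D} {E} (step m tt π) , λ E≐D →
  <⇒≢ (≤-<-trans (height-reach (bounded-move bound m) π) (height-move-< bound m)) (height-cong N E≐D)

≺-height : ∀ {N} D E → Bounded N ⟦ D ⟧ → E ≺ D → height N ⟦ E ⟧ < height N ⟦ D ⟧
≺-height D E bound E≺D with ≺-move D E E≺D
... | h , m , π = ≤-<-trans (height-reach (bounded-move bound m) π) (height-move-< bound m)

-- Each strict relation lowers the height by at least 1, so an intermediate diagram would force a
-- drop of 2, while a unit move drops by exactly 1.
unit-cover : ∀ {N} D E → Bounded N ⟦ D ⟧ → (m : Move ⟦ D ⟧ ⟦ E ⟧) → top m ≡ suc (bot m) → Covers D E
unit-cover D E bound m unit = move-≺ D E bound m (done λ _ → refl) , λ { (z , E≺z , z≺D) →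
  <⇒≱ (≺-height D z bound z≺D)
      (≤-trans (≤-reflexive (height-drop bound m 1 unit))
               (≺-height z E (bounded-reach bound (⪯⇒reach D z (proj₁ z≺D))) E≺z)) }

height-drop⁻ : ∀ {N f g} → Bounded N f → (m : Move f g) → height N f ≡ suc (height N g) → top m ≡ suc (bot m)
height-drop⁻ {N} {f} {g} bound m e = +-cancelˡ-≡ (height N g) _ _ (begin
  height N g + top m       ≡⟨ height-move bound m ⟨
  height N f + bot m       ≡⟨ cong (_+ bot m) e ⟩
  suc (height N g + bot m) ≡⟨ +-suc _ _ ⟨
  height N g + suc (bot m) ∎)
  where open ≡-Reasoning

-- A cell of the skipped row lying to the right pins that row, so the jump cannot be split
-- into two unit moves.
jump-cover : ∀ {N} D E → Bounded N ⟦ D ⟧ → (m : Move ⟦ D ⟧ ⟦ E ⟧) → top m ≡ 2 + bot m →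
             ∀ {c} → col m < c → ⟦ D ⟧ (suc (bot m) , c) ≡ true → Covers D E
jump-cover {N} D E bound m jump {c} k<c pin = move-≺ D E bound m (done λ _ → refl) , λ { (z , E≺z , z≺D) →
  split z (≺-move D z z≺D) (≺-move z E E≺z) }
  where
  b k : ℕ
  b = bot m
  k = col m

  H : Config → ℕ
  H = height N

  -- The total drop is 2 and each of the two strict relations uses up at least 1 of it, so each is a
  -- single unit move.
  split : ∀ z → (∃ λ h → Move ⟦ D ⟧ h × Reach h ⟦ z ⟧) → (∃ λ h → Move ⟦ z ⟧ h × Reach h ⟦ E ⟧) → ⊥
  split z (f , m₁ , π₁) (g , m₂ , π₂) = refute (slide⁻ _ _ f (b , k) target)
    where
    bound₁ : Bounded N f
    bound₁ = bounded-move bound m₁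

    bound-z : Bounded N ⟦ z ⟧
    bound-z = bounded-reach bound₁ π₁

    total : H ⟦ D ⟧ ≡ 2 + H ⟦ E ⟧
    total = height-drop bound m 2 jump

    E<z : H ⟦ E ⟧ < H ⟦ z ⟧
    E<z = ≤-<-trans (height-reach (bounded-move bound-z m₂) π₂) (height-move-< bound-z m₂)

    z≤f : H ⟦ z ⟧ ≤ H f
    z≤f = height-reach bound₁ π₁

    f≤E+1 : H f ≤ suc (H ⟦ E ⟧)
    f≤E+1 = s≤s⁻¹ (≤-trans (height-move-< bound m₁) (≤-reflexive total))

    f≗z : f ≗ ⟦ z ⟧
    f≗z = reach-level bound₁ π₁ (≤-trans f≤E+1 E<z)

    g≗E : g ≗ ⟦ E ⟧
    g≗E = reach-level (bounded-move bound-z m₂) π₂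
      (s≤s⁻¹ (≤-trans (height-move-< bound-z m₂) (≤-trans z≤f f≤E+1)))

    m₂′ : Move f ⟦ E ⟧
    m₂′ = move-respˡ (≗-sym f≗z) (move-respʳ g≗E m₂)

    unit₁ : top m₁ ≡ suc (bot m₁)
    unit₁ = height-drop⁻ bound m₁ (trans total (cong suc (≤-antisym (≤-trans E<z z≤f) f≤E+1)))

    unit₂ : top m₂′ ≡ suc (bot m₂′)
    unit₂ = height-drop⁻ bound₁ m₂′ (≤-antisym f≤E+1 (≤-trans E<z z≤f))

    target : slide (top m₂′ , col m₂′) (bot m₂′ , col m₂′) f (b , k) ≡ true
    target = trans (sym (effect m₂′ (b , k))) (trans (effect m (b , k)) (slide-target (top m , k) (b , k) ⟦ D ⟧))

    E-pin : ⟦ E ⟧ (suc b , c) ≡ true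
    E-pin = trans (move-column m (suc b) (>⇒≢ k<c)) pin

    -- One of the two moves must fill `(b , k)`. Being a unit move, it takes the cell of row `suc b`
    -- in column `k`, which is not rightmost because of the pin in column `c`.
    refute : (b , k) ≡ (bot m₂′ , col m₂′) ⊎ ((b , k) ≢ (top m₂′ , col m₂′) × f (b , k) ≡ true) → ⊥
    refute (inj₁ refl) = true≢false E-pin (trans (move-column m₂′ (suc b) (>⇒≢ k<c))
      (subst (λ r → f (r , c) ≡ false) unit₂ (rightmost m₂′ k<c)))
    refute (inj₂ (_ , o)) with slide⁻ _ _ ⟦ D ⟧ (b , k) (trans (sym (effect m₁ (b , k))) o)
    ... | inj₁ refl    = true≢false pin (subst (λ r → ⟦ D ⟧ (r , c) ≡ false) unit₁ (rightmost m₁ k<c))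
    ... | inj₂ (_ , o′) = true≢false o′ (vacant m)

-- Key diagrams as row-length functions

young : (ℕ → ℕ) → Config
young ℓ (r , zero)  = false
young ℓ (r , suc c) = c <ᵇ ℓ r

young-in : ∀ ℓ {r c} → 0 < c → c ≤ ℓ r → young ℓ (r , c) ≡ true
young-in ℓ {r} {suc c} _ c<ℓ = dec-true (c <? ℓ r) c<ℓ

young-out : ∀ ℓ {r c} → ℓ r < c → young ℓ (r , c) ≡ false
young-out ℓ {r} {suc c} ℓ<c = dec-false (c <? ℓ r) (≤⇒≯ (s≤s⁻¹ ℓ<c))

young-in⁻ : ∀ ℓ r c → young ℓ (r , c) ≡ true → 0 < c × c ≤ ℓ r
young-in⁻ ℓ r (suc c) o = z<s , <ᵇ⇒< c (ℓ r) (Equivalence.from T-≡ o)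

young-out⁻ : ∀ ℓ r {c} → 0 < c → young ℓ (r , c) ≡ false → ℓ r < c
young-out⁻ ℓ r 0<c v = ≰⇒> λ c≤ℓ → true≢false (young-in ℓ 0<c c≤ℓ) v

row : List ℕ → ℕ → ℕ
row []      _       = 0
row (x ∷ a) zero    = x
row (x ∷ a) (suc k) = row a k

shape : WeakComp → ℕ → ℕ
shape a zero    = 0
shape a (suc k) = row a k

∈ᵇ⇒∈ : ∀ x D → x ∈ᵇ D ≡ true → x ∈ D
∈ᵇ⇒∈ x D o = Any.map (λ {y} → ==ᶜ⇒≡ x y ∘ Equivalence.to T-≡) (any⁻ (x ==ᶜ_) D (Equivalence.from T-≡ o))

∈⇒∈ᵇ : ∀ {x D} → x ∈ D → x ∈ᵇ D ≡ true
∈⇒∈ᵇ {x} x∈D = Equivalence.to T-≡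
  (any⁺ (x ==ᶜ_) (Any.map (λ { refl → Equivalence.from T-≡ (==ᶜ-refl x) }) x∈D))

keyRows⁻ : ∀ i a {r c} → (r , c) ∈ keyRows i a → ∃ λ k → r ≡ i + k × 0 < c × c ≤ row a k
keyRows⁻ i (x ∷ a) p with ∈-++⁻ (map (λ j → i , suc j) (upTo x)) p
... | inj₁ q with ∈-map⁻ _ q
... | j , j∈ , refl = 0 , sym (+-identityʳ i) , z<s , ∈-upTo⁻ j∈
keyRows⁻ i (x ∷ a) p | inj₂ q with keyRows⁻ (suc i) a q
... | k , refl , rest = suc k , sym (+-suc i k) , rest

keyRows⁺ : ∀ i a k {c} → 0 < c → c ≤ row a k → (i + k , c) ∈ keyRows i a
keyRows⁺ i []      k       {suc c} _   ()
keyRows⁺ i (x ∷ a) zero    {suc c} _   c<x rewrite +-identityʳ i =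
  ∈-++⁺ˡ (∈-map⁺ (λ j → i , suc j) (∈-upTo⁺ c<x))
keyRows⁺ i (x ∷ a) (suc k) 0<c c≤ rewrite +-suc i k =
  ∈-++⁺ʳ (map (λ j → i , suc j) (upTo x)) (keyRows⁺ (suc i) a k 0<c c≤)

key≗young : ∀ a → ⟦ keyDiagram a ⟧ ≗ young (shape a)
key≗young a (r , c) = ⇔→≡ {z = true} (mk⇔ to (∈⇒∈ᵇ ∘ from r))
  where
  to : (r , c) ∈ᵇ keyDiagram a ≡ true → young (shape a) (r , c) ≡ true
  to o with keyRows⁻ 1 a (∈ᵇ⇒∈ (r , c) (keyDiagram a) o)
  ... | k , refl , 0<c , c≤ = young-in (shape a) {suc k} 0<c c≤

  from : ∀ r → young (shape a) (r , c) ≡ true → (r , c) ∈ keyDiagram a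
  from r o with young-in⁻ (shape a) r c o
  from zero    o | 0<c , c≤0 = contradiction c≤0 (<⇒≱ 0<c)
  from (suc k) o | 0<c , c≤  = keyRows⁺ 1 a k 0<c c≤

-- The three forbidden patterns say together that both later entries exceed the first and that one
-- of them does so by at least 2.
Bad : (ℕ → ℕ) → ℕ → ℕ → ℕ → Set
Bad ℓ i j k = ℓ i < ℓ j × ℓ i < ℓ k × (suc (ℓ i) < ℓ j ⊎ suc (ℓ i) < ℓ k)

PureShape : (ℕ → ℕ) → Set
PureShape ℓ = ∀ {i j k} → 0 < i → i < j → j < k → ¬ Bad ℓ i j k

row-lookup : ∀ a (j : Fin (length a)) → lookup a j ≡ row a (toℕ j)
row-lookup (x ∷ a) Fin.zero    = refl
row-lookup (x ∷ a) (Fin.suc j) = row-lookup a j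

-- Rows past the end have the default length 0, which is never larger than another entry. Hence a
-- `Bad` triple of rows always consists of genuine entries of `a`.
row-length : ∀ a k → 0 < row a k → k < length a
row-length (x ∷ a) zero    _ = z<s
row-length (x ∷ a) (suc k) p = s<s (row-length a k p)

pure⇒pureShape : ∀ a → Pure a → PureShape (shape a)
pure⇒pureShape a pure {suc i} {suc j} {suc k} _ (s<s i<j) (s<s j<k) (x<y , x<z , big) =
  pure (fromℕ< i<n) (fromℕ< j<n) (fromℕ< k<n) (mono i<n j<n i<j) (mono j<n k<n j<k)
    (subst₃ (sym (at i<n)) (sym (at j<n)) (sym (at k<n)) (patterns (<-cmp (row a j) (row a k)) big))
  where
  k<n : k < length a
  k<n = row-length a k (m<n⇒0<n x<z)
  j<n : j < length a
  j<n = <-trans j<k k<n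
  i<n : i < length a
  i<n = <-trans i<j j<n

  at : ∀ {m} (m<n : m < length a) → lookup a (fromℕ< m<n) ≡ row a m
  at m<n = trans (row-lookup a (fromℕ< m<n)) (cong (row a) (toℕ-fromℕ< m<n))

  mono : ∀ {m m′} (p : m < length a) (q : m′ < length a) → m < m′ → toℕ (fromℕ< p) < toℕ (fromℕ< q)
  mono p q = subst₂ _<_ (sym (toℕ-fromℕ< p)) (sym (toℕ-fromℕ< q))

  Pattern : ℕ → ℕ → ℕ → Set
  Pattern x y z = (x < y × y < z) ⊎ (x < z × z < y) ⊎ (suc x < y × y ≡ z)

  subst₃ : ∀ {x x′ y y′ z z′} → x ≡ x′ → y ≡ y′ → z ≡ z′ → Pattern x y z → Pattern x′ y′ z′
  subst₃ refl refl refl p = p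

  patterns : Tri (row a j < row a k) (row a j ≡ row a k) (row a j > row a k) →
             suc (row a i) < row a j ⊎ suc (row a i) < row a k → Pattern (row a i) (row a j) (row a k)
  patterns (tri< y<z _ _) _        = inj₁ (x<y , y<z)
  patterns (tri> _ _ y>z) _        = inj₂ (inj₁ (x<z , y>z))
  patterns (tri≈ _ y≡z _) (inj₁ p) = inj₂ (inj₂ (p , y≡z))
  patterns (tri≈ _ y≡z _) (inj₂ p) = inj₂ (inj₂ (subst (suc (row a i) <_) (sym y≡z) p , y≡z))

pureShape⇒pure : ∀ a → PureShape (shape a) → Pure a
pureShape⇒pure a pure i j k i<j j<k p = pure z<s (s<s i<j) (s<s j<k)
  (bad (row-lookup a i) (row-lookup a j) (row-lookup a k) p)
  where
  bad : ∀ {x x′ y y′ z z′} → x ≡ x′ → y ≡ y′ → z ≡ z′ →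
        (x < y × y < z) ⊎ (x < z × z < y) ⊎ (suc x < y × y ≡ z) →
        x′ < y′ × x′ < z′ × (suc x′ < y′ ⊎ suc x′ < z′)
  bad refl refl refl (inj₁ (x<y , y<z))           = x<y , <-trans x<y y<z , inj₂ (≤-<-trans x<y y<z)
  bad refl refl refl (inj₂ (inj₁ (x<z , z<y)))    = <-trans x<z z<y , x<z , inj₁ (≤-<-trans x<z z<y)
  bad refl refl refl (inj₂ (inj₂ (1+x<y , refl))) = <⇒≤ 1+x<y , <⇒≤ 1+x<y , inj₁ 1+x<y

-- Pure compositions

-- Traces of the initial diagram that survive every move: within a column cells only go down and
-- vacancies only go up. Counting up to two cells suffices for patterns of three entries.
record Below (f₀ f : Config) : Set where
  field
    one  : ∀ {r c} → f (r , c) ≡ true → ∃ λ j → r ≤ j × f₀ (j , c) ≡ true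
    two  : ∀ {r s c} → r < s → f (r , c) ≡ true → f (s , c) ≡ true →
           ∃₂ λ i j → r ≤ i × i < j × f₀ (i , c) ≡ true × f₀ (j , c) ≡ true
    gap  : ∀ {r c} → 0 < r → f (r , c) ≡ false → ∃ λ i → 0 < i × i ≤ r × f₀ (i , c) ≡ false

below-refl : ∀ {f₀ f} → f₀ ≗ f → Below f₀ f
below-refl e = record
  { one = λ o → _ , ≤-refl , trans (e _) o
  ; two = λ r<s o o′ → _ , _ , ≤-refl , r<s , trans (e _) o , trans (e _) o′
  ; gap = λ 0<r v → _ , 0<r , ≤-refl , trans (e _) v }

below-move : ∀ {f₀ f g} → Below f₀ f → Move f g → Below f₀ g
below-move {f₀} {f} {g} B m = record { one = one′ ; two = two′ ; gap = gap′ }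
  where
  open Below B

  back : ∀ r c → g (r , c) ≡ true → (r , c) ≡ (bot m , col m) ⊎ ((r , c) ≢ (top m , col m) × f (r , c) ≡ true)
  back r c o = slide⁻ _ _ f (r , c) (trans (sym (effect m (r , c))) o)

  one′ : ∀ {r c} → g (r , c) ≡ true → ∃ λ j → r ≤ j × f₀ (j , c) ≡ true
  one′ {r} {c} o with back r c o
  ... | inj₂ (_ , o′) = one o′
  ... | inj₁ refl with one (occupied m)
  ... | j , top≤j , o₀ = j , <⇒≤ (<-≤-trans (bot<top m) top≤j) , o₀

  two′ : ∀ {r s c} → r < s → g (r , c) ≡ true → g (s , c) ≡ true →
         ∃₂ λ i j → r ≤ i × i < j × f₀ (i , c) ≡ true × f₀ (j , c) ≡ true
  two′ {r} {s} {c} r<s o o′ with back r c o | back s c o′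
  ... | inj₁ refl | inj₁ refl = contradiction r<s (<-irrefl refl)
  ... | inj₂ (_ , p) | inj₁ refl = two (<-trans r<s (bot<top m)) p (occupied m)
  ... | inj₂ (_ , p) | inj₂ (_ , p′) = two r<s p p′
  -- The lower cell is the one just moved. Before the move it stood at `top m`, below or above `s`,
  -- and the pair is counted there.
  ... | inj₁ refl | inj₂ (s≢top , p′) with <-cmp s (top m)
  ... | tri≈ _ refl _ = contradiction refl s≢top
  ... | tri< s<top _ _ = let i , j , s≤i , rest = two s<top p′ (occupied m) in
                         i , j , ≤-trans (<⇒≤ r<s) s≤i , rest
  ... | tri> _ _ top<s = let i , j , top≤i , rest = two top<s (occupied m) p′ in
                         i , j , ≤-trans (<⇒≤ (bot<top m)) top≤i , rest

  gap′ : ∀ {r c} → 0 < r → g (r , c) ≡ false → ∃ λ i → 0 < i × i ≤ r × f₀ (i , c) ≡ false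
  gap′ {r} {c} 0<r v with (r , c) ≟ᶜ (top m , col m) | (r , c) ≟ᶜ (bot m , col m)
  ... | _ | yes refl = contradiction v (true≢false (trans (effect m _) (slide-target (top m , col m) (bot m , col m) f)))
  ... | no r≢top | no r≢bot = gap 0<r (trans (sym (trans (effect m _) (slide-other f r≢top r≢bot))) v)
  -- The position was vacated by the move itself; the vacancy it was traded for lies lower and has
  -- an origin lower still or equal.
  ... | yes refl | no _ = let i , 0<i , i≤bot , v₀ = gap (0<bot m) (vacant m) in
                          i , 0<i , ≤-trans i≤bot (<⇒≤ (bot<top m)) , v₀

below-reach : ∀ {f₀ f g} → Below f₀ f → Reach f g → Below f₀ g
below-reach B (done e) = record
  { one = λ o → one (trans (e _) o)
  ; two = λ r<s o o′ → two r<s (trans (e _) o) (trans (e _) o′)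
  ; gap = λ 0<r v → gap 0<r (trans (e _) v) }
  where open Below B
below-reach B (step m _ π) = below-reach (below-move B m) π

skipped-rightmost : ∀ {ℓ f g} → PureShape ℓ → Below (young ℓ) f → (m : Move f g) →
                    ∀ {s c} → bot m < s → s < top m → col m < c → f (s , c) ≡ false
skipped-rightmost {ℓ} {f} pure B m {s} {c} bot<s s<top k<c = ¬-not refute
  where
  open Below B

  refute : f (s , c) ≢ true
  refute o with gap (0<bot m) (vacant m) | two s<top (full m bot<s s<top) (occupied m) | one o
  ... | i , 0<i , i≤bot , v | j₁ , j₂ , s≤j₁ , j₁<j₂ , o₁ , o₂ | j , s≤j , o₀
    with young-in⁻ ℓ j₁ (col m) o₁ | young-in⁻ ℓ j₂ (col m) o₂ | young-in⁻ ℓ j c o₀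
  ... | 0<k , k≤ℓj₁ | _ , k≤ℓj₂ | _ , c≤ℓj = by-order (<-cmp j j₁)
    where
    small : ℓ i < col m
    small = young-out⁻ ℓ i 0<k v

    large : suc (ℓ i) < ℓ j
    large = ≤-<-trans small (<-≤-trans k<c c≤ℓj)

    above : ∀ {n} → s ≤ n → i < n
    above s≤n = ≤-<-trans i≤bot (<-≤-trans bot<s s≤n)

    -- Row `j` supplies the excess of at least 2 over row `i`. Its partner is `j₁`, in whichever
    -- order they come, or `j₂` if `j` and `j₁` coincide.
    by-order : Tri (j < j₁) (j ≡ j₁) (j > j₁) → ⊥
    by-order (tri< j<j₁ _ _) = pure 0<i (above s≤j) j<j₁ (<⇒≤ large , <-≤-trans small k≤ℓj₁ , inj₁ large)
    by-order (tri> _ _ j₁<j) = pure 0<i (above s≤j₁) j₁<j (<-≤-trans small k≤ℓj₁ , <⇒≤ large , inj₂ large)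
    by-order (tri≈ _ refl _) = pure 0<i (above s≤j) j₁<j₂ (<⇒≤ large , <-≤-trans small k≤ℓj₂ , inj₁ large)

-- A longer move from a pure shape factors through first moving down the lowest skipped cell.
cover-unit : ∀ {N ℓ} D E → PureShape ℓ → Bounded N ⟦ D ⟧ → Below (young ℓ) ⟦ D ⟧ → Covers D E →
             height N ⟦ D ⟧ ≡ suc (height N ⟦ E ⟧)
cover-unit {N} {ℓ} D E pure bound B (E≺D , tight) with ≺-move D E E≺D
... | h , m , π with m≤n⇒m<n∨m≡n (bot<top m)
... | inj₂ unit = finish π
  where
  finish : Reach h ⟦ E ⟧ → height N ⟦ D ⟧ ≡ suc (height N ⟦ E ⟧)
  finish (done e) = trans (height-drop bound m 1 (sym unit)) (cong suc (height-cong N e))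
  -- If the path goes on after `m`, the diagram reached by `m` lies strictly between.
  finish (step m′ _ π′) with realise D (λ _ → refl) (step m tt (done λ _ → refl))
  ... | z , s , z≗h = contradiction
    (z , move-≺ z E (bounded-resp (≗-sym z≗h) (bounded-move bound m)) (move-respˡ (≗-sym z≗h) m′) π′
       , move-≺ D z bound m (done (≗-sym z≗h)))
    tight
... | inj₁ 1+bot<top = contradiction between tight
  where
  t b k : ℕ
  t = top m
  b = bot m
  k = col m

  f g : Config
  f = ⟦ D ⟧
  g = slide (suc b , k) (b , k) f

  lower-first : Move f g
  lower-first = record
    { top = suc b ; bot = b ; col = k ; 0<bot = 0<bot m ; bot<top = ≤-refl
    ; occupied = full m ≤-refl 1+bot<top
    ; rightmost = skipped-rightmost pure B m ≤-refl 1+bot<top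
    ; vacant = vacant m
    ; full = λ b<s s<1+b → contradiction s<1+b (≤⇒≯ b<s)
    ; effect = λ _ → refl }

  g-off : ∀ {r} c → r ≢ b → r ≢ suc b → g (r , c) ≡ f (r , c)
  g-off {r} c r≢b r≢1+b = slide-other f {r , c} (row≢ r≢1+b) (row≢ r≢b)

  then-jump : Move g h
  then-jump = record
    { top = t ; bot = suc b ; col = k ; 0<bot = z<s ; bot<top = 1+bot<top
    ; occupied = trans (g-off k (>⇒≢ (bot<top m)) (>⇒≢ 1+bot<top)) (occupied m)
    ; rightmost = λ {c} k<c → trans (g-off c (>⇒≢ (bot<top m)) (>⇒≢ 1+bot<top)) (rightmost m k<c)
    ; vacant = slide-source {suc b , k} f (row≢ 1+n≢n)
    ; full = λ 1+b<s s<t → trans (g-off k (>⇒≢ (<⇒≤ 1+b<s)) (>⇒≢ 1+b<s)) (full m (<⇒≤ 1+b<s) s<t)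
    ; effect = same }
    where
    -- Cells carry no labels: the top cell lands at `suc b` and refills what `lower-first` vacated,
    -- which gives the result of the single long move.
    same : h ≗ slide (t , k) (suc b , k) g
    same x with x ≟ᶜ (suc b , k) | x ≟ᶜ (b , k) | x ≟ᶜ (t , k)
    ... | yes refl | _ | _ = trans (effect m x)
      (trans (slide-other f (row≢ {suc b} {t} {k} {k} (<⇒≢ 1+bot<top)) (row≢ {suc b} {b} 1+n≢n))
             (trans (full m ≤-refl 1+bot<top) (sym (slide-target (t , k) (suc b , k) g))))
    ... | no x≢s | yes refl | _ = trans (effect m x) (trans (slide-target (t , k) x f)
      (sym (trans (slide-other g (row≢ {b} {t} {k} {k} (<⇒≢ (bot<top m))) x≢s) (slide-target (suc b , k) x f))))
    ... | no x≢s | no x≢b | yes refl = trans (effect m x) (trans (slide-source f x≢b) (sym (slide-source g x≢s)))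
    ... | no x≢s | no x≢b | no x≢t = trans (effect m x) (trans (slide-other f x≢t x≢b)
      (sym (trans (slide-other g x≢t x≢s) (slide-other f x≢s x≢b))))

  between : ∃ λ z → (E ≺ z) × (z ≺ D)
  between with realise D (λ _ → refl) (step lower-first tt (done λ _ → refl))
  ... | z , _ , z≗g =
    z , move-≺ z E (bounded-resp (≗-sym z≗g) (bounded-move bound lower-first)) (move-respˡ (≗-sym z≗g) then-jump) π
      , move-≺ D z bound lower-first (done (≗-sym z≗g))

pure⇒ranked : ∀ a → Pure a → Ranked (keyDiagram a)
pure⇒ranked a pure with bounded (keyDiagram a)
-- Moves never leave the box of the initial diagram, so one `N` serves the whole poset.
... | N , bound = (λ D → height N ⟦ D ⟧)
  , (λ D E _ _ D≐E → height-cong N D≐E)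
  , (λ D E _ E∈KD D≺E → ≺-height E D (bound-at E E∈KD) D≺E)
  , (λ D E _ E∈KD cover → cover-unit E D (pure⇒pureShape a pure) (bound-at E E∈KD) (below-at E E∈KD) cover)
  where
  bound-at : ∀ D → InKD (keyDiagram a) D → Bounded N ⟦ D ⟧
  bound-at D D∈KD = bounded-reach bound (⪯⇒reach (keyDiagram a) D D∈KD)

  below-at : ∀ D → InKD (keyDiagram a) D → Below (young (shape a)) ⟦ D ⟧
  below-at D D∈KD = below-reach (below-refl (≗-sym (key≗young a))) (⪯⇒reach (keyDiagram a) D D∈KD)

-- Lowering a row

-- A closed form for dropping the part of row `suc r` beyond column `lo` by one row. The `∨` loses
-- no cell under the disjointness hypothesis of `lower-path`.
lower : ℕ → ℕ → Config → Config
lower r lo f (s , c) =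
  if lo <ᵇ c
  then (if s ≡ᵇ r then f (r , c) ∨ f (suc r , c) else (if s ≡ᵇ suc r then false else f (s , c)))
  else f (s , c)

lower-left : ∀ r {lo} f s {c} → c ≤ lo → lower r lo f (s , c) ≡ f (s , c)
lower-left r {lo} f s {c} c≤lo rewrite dec-false (lo <? c) (≤⇒≯ c≤lo) = refl

lower-to : ∀ r {lo} f {c} → lo < c → lower r lo f (r , c) ≡ f (r , c) ∨ f (suc r , c)
lower-to r {lo} f {c} lo<c rewrite dec-true (lo <? c) lo<c | dec-true (r ≟ r) refl = refl

lower-from : ∀ r {lo} f {c} → lo < c → lower r lo f (suc r , c) ≡ false
lower-from r {lo} f {c} lo<c
  rewrite dec-true (lo <? c) lo<c | dec-false (suc r ≟ r) 1+n≢n | dec-true (r ≟ r) refl = refl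

lower-off : ∀ r lo f {s} c → s ≢ r → s ≢ suc r → lower r lo f (s , c) ≡ f (s , c)
lower-off r lo f {s} c s≢r s≢1+r rewrite dec-false (s ≟ r) s≢r | dec-false (s ≟ suc r) s≢1+r with lo <ᵇ c
... | true  = refl
... | false = refl

lower-agree : ∀ r {lo lo′} f g s {c} → lo < c → lo′ < c → (∀ s → f (s , c) ≡ g (s , c)) →
              lower r lo f (s , c) ≡ lower r lo′ g (s , c)
lower-agree r {lo} {lo′} f g s {c} lo<c lo′<c e
  rewrite dec-true (lo <? c) lo<c | dec-true (lo′ <? c) lo′<c | e r | e (suc r) | e s = refl

lower-vacant : ∀ r lo f s c → f (suc r , c) ≡ false → lower r lo f (s , c) ≡ f (s , c)
lower-vacant r lo f s c v with c ≤? lo | s ≟ r | s ≟ suc r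
... | yes c≤lo | _ | _ = lower-left r f s c≤lo
... | no c≰lo | yes refl | _ = trans (lower-to r f (≰⇒> c≰lo)) (trans (cong (f (r , c) ∨_) v) (∨-identityʳ _))
... | no c≰lo | no _ | yes refl = trans (lower-from r f (≰⇒> c≰lo)) (sym v)
... | no c≰lo | no s≢r | no s≢1+r = lower-off r lo f c s≢r s≢1+r

-- Each cell moved is the rightmost of its row, so cells are lowered from right to left.
lower-path : ∀ r lo n f → 0 < r → (∀ {c} → lo + n < c → f (suc r , c) ≡ false) →
             (∀ {c} → lo < c → f (suc r , c) ≡ true → f (r , c) ≡ false) → UnitPath f (lower r lo f)
lower-path r lo zero f 0<r end apart = done same
  where
  same : f ≗ lower r lo f
  same (s , c) with c ≤? lo
  ... | yes c≤lo = sym (lower-left r f s c≤lo)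
  ... | no c≰lo  = sym (lower-vacant r lo f s c (end (subst (_< c) (sym (+-identityʳ lo)) (≰⇒> c≰lo))))
lower-path r lo (suc n) f 0<r end apart = by-cell (f (suc r , k)) refl
  where
  -- The induction is on the width of the strip beyond `lo` that may still hold cells of row
  -- `suc r`; `k` is its last column.
  k : ℕ
  k = lo + suc n

  lo<k : lo < k
  lo<k = m<m+n lo z<s

  shrink : ∀ {c} → lo + n < c → c ≢ k → k < c
  shrink {c} lo+n<c c≢k = ≤∧≢⇒< (subst (_≤ c) (sym (+-suc lo n)) lo+n<c) (c≢k ∘ sym)

  g : Config
  g = slide (suc r , k) (r , k) f

  g-off : ∀ s {c} → c ≢ k → g (s , c) ≡ f (s , c)
  g-off s {c} c≢k = slide-other f {s , c} (column≢ c≢k) (column≢ c≢k)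

  g-from : g (suc r , k) ≡ false
  g-from = slide-source {suc r , k} {r , k} f (row≢ 1+n≢n)

  by-cell : ∀ b → f (suc r , k) ≡ b → UnitPath f (lower r lo f)
  by-cell false v = lower-path r lo n f 0<r end′ apart
    where
    end′ : ∀ {c} → lo + n < c → f (suc r , c) ≡ false
    end′ {c} lo+n<c with c ≟ k
    ... | yes refl = v
    ... | no c≢k   = end (shrink lo+n<c c≢k)
  by-cell true o = step m refl (path-trans (lower-path r lo n g 0<r end′ apart′) (done same))
    where
    m : Move f g
    m = record
      { top = suc r ; bot = r ; col = k ; 0<bot = 0<r ; bot<top = ≤-refl
      ; occupied = o ; rightmost = end ; vacant = apart lo<k o
      ; full = λ r<s s<1+r → contradiction s<1+r (≤⇒≯ r<s)
      ; effect = λ _ → refl }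

    end′ : ∀ {c} → lo + n < c → g (suc r , c) ≡ false
    end′ {c} lo+n<c with c ≟ k
    ... | yes refl = g-from
    ... | no c≢k   = trans (g-off (suc r) c≢k) (end (shrink lo+n<c c≢k))

    apart′ : ∀ {c} → lo < c → g (suc r , c) ≡ true → g (r , c) ≡ false
    apart′ {c} lo<c o′ with c ≟ k
    ... | yes refl = contradiction g-from (true≢false o′)
    ... | no c≢k   = trans (g-off r c≢k) (apart lo<c (trans (sym (g-off (suc r) c≢k)) o′))

    same : lower r lo g ≗ lower r lo f
    same (s , c) with c ≟ k | c ≤? lo | s ≟ r | s ≟ suc r
    ... | no c≢k | yes c≤lo | _ | _ = trans (lower-left r g s c≤lo) (trans (g-off s c≢k) (sym (lower-left r f s c≤lo)))
    ... | no c≢k | no c≰lo | _ | _ = lower-agree r g f s (≰⇒> c≰lo) (≰⇒> c≰lo) (λ s → g-off s c≢k)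
    ... | yes refl | _ | yes refl | _ = trans (lower-to r g lo<k)
      (trans (∨-trueˡ (slide-target (suc r , k) (r , k) f)) (sym (trans (lower-to r f lo<k) (∨-trueʳ {f (r , k)} o))))
    ... | yes refl | _ | no _ | yes refl = trans (lower-from r g lo<k) (sym (lower-from r f lo<k))
    ... | yes refl | _ | no s≢r | no s≢1+r = trans (lower-off r lo g k s≢r s≢1+r)
      (trans (slide-other f {s , k} (row≢ s≢1+r) (row≢ s≢r)) (sym (lower-off r lo f k s≢r s≢1+r)))

-- Ranked posets

forget : ∀ {f g} → UnitPath f g → Reach f g
forget (done e)     = done e
forget (step m _ π) = step m tt (forget π)

module RankFunction (D₀ : Diagram) (ranked : Ranked D₀) where

  rank : Diagram → ℕ
  rank = proj₁ ranked

  N : ℕ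
  N = proj₁ (bounded D₀)

  in-box : ∀ D → InKD D₀ D → Bounded N ⟦ D ⟧
  in-box D D∈KD = bounded-reach (proj₂ (bounded D₀)) (⪯⇒reach D₀ D D∈KD)

  move-target : ∀ D {f h} → ⟦ D ⟧ ≗ f → InKD D₀ D → Move f h →
                ∃ λ E → InKD D₀ E × ⟦ E ⟧ ≗ h
  move-target D D≗f D∈KD m with realise D D≗f (step m tt (done λ _ → refl))
  ... | E , s , E≗h = E , ⪯-trans {D₀} {D} {E} (E , s , λ _ → refl) D∈KD , E≗h

  -- Every unit move is a cover, so rank and height fall by the same amount; the crosswise sums
  -- express this without subtraction.
  rank-unit-path : ∀ D {f g} → ⟦ D ⟧ ≗ f → InKD D₀ D → UnitPath f g →
                   ∃ λ E → InKD D₀ E × ⟦ E ⟧ ≗ g × rank D + height N g ≡ rank E + height N f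
  rank-unit-path D D≗f D∈KD (done f≗g) =
    D , D∈KD , ≗-trans D≗f f≗g , cong (rank D +_) (sym (height-cong N f≗g))
  rank-unit-path D {f} {g} D≗f D∈KD (step {h} m unit π) with move-target D D≗f D∈KD m
  ... | E , E∈KD , E≗h with rank-unit-path E E≗h E∈KD π
  ... | F , F∈KD , F≗g , e = F , F∈KD , F≗g , (begin
    rank D + height N g         ≡⟨ cong (_+ height N g) (proj₂ (proj₂ (proj₂ ranked)) E D E∈KD D∈KD cover) ⟩
    suc (rank E + height N g)   ≡⟨ cong suc e ⟩
    suc (rank F + height N h)   ≡⟨ +-suc (rank F) (height N h) ⟨
    rank F + suc (height N h)   ≡⟨ cong (rank F +_) (height-drop bound m 1 unit) ⟨
    rank F + height N f         ∎)
    where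
    open ≡-Reasoning
    bound : Bounded N f
    bound = bounded-resp D≗f (in-box D D∈KD)
    cover : Covers D E
    cover = unit-cover D E (in-box D D∈KD) (move-respˡ (≗-sym D≗f) (move-respʳ (≗-sym E≗h) m)) unit

  -- A jump cover loses height 2 but rank 1, while along unit paths both drop equally.
  no-bypass : ∀ {f u v w} → Reach ⟦ D₀ ⟧ f → UnitPath f u → UnitPath v w → UnitPath f w →
              (m : Move u v) → top m ≡ 2 + bot m → ∀ {c} → col m < c → u (suc (bot m) , c) ≡ true → ⊥
  no-bypass {f} {u} {v} {w} start π₁ π₂ π₃ m jump k<c pin with realise D₀ (λ _ → refl) start
  ... | D , s , D≗f with rank-unit-path D D≗f (D , s , λ _ → refl) π₁
  ... | U , U∈KD , U≗u , e₁ with move-target U U≗u U∈KD m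
  ... | V , V∈KD , V≗v with rank-unit-path V V≗v V∈KD π₂ | rank-unit-path D D≗f (D , s , λ _ → refl) π₃
  ... | W , W∈KD , W≗w , e₂ | W′ , W′∈KD , W′≗w , e₃ = 1+n≢n (begin
    2 + (rank W + H f + H v)   ≡⟨ solve 3 (λ p q r → con 2 :+ (p :+ q :+ r) := p :+ q :+ (con 2 :+ r)) refl (rank W) (H f) (H v) ⟩
    rank W + H f + (2 + H v)   ≡⟨ cong₂ _+_ (cong (_+ H f) (proj₁ (proj₂ ranked) W W′ W∈KD W′∈KD W≐W′)) (sym drop) ⟩
    rank W′ + H f + H u        ≡⟨ cong (_+ H u) e₃ ⟨
    rank D + H w + H u         ≡⟨ solve 3 (λ p q r → p :+ q :+ r := p :+ r :+ q) refl (rank D) (H w) (H u) ⟩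
    rank D + H u + H w         ≡⟨ cong (_+ H w) e₁ ⟩
    rank U + H f + H w         ≡⟨ cong (λ n → n + H f + H w) (proj₂ (proj₂ (proj₂ ranked)) V U V∈KD U∈KD cover) ⟩
    suc (rank V) + H f + H w   ≡⟨ solve 3 (λ p q r → con 1 :+ p :+ q :+ r := con 1 :+ (p :+ r :+ q)) refl (rank V) (H f) (H w) ⟩
    suc (rank V + H w + H f)   ≡⟨ cong (λ n → suc (n + H f)) e₂ ⟩
    suc (rank W + H v + H f)   ≡⟨ solve 3 (λ p q r → con 1 :+ (p :+ q :+ r) := con 1 :+ (p :+ r :+ q)) refl (rank W) (H v) (H f) ⟩
    suc (rank W + H f + H v)   ∎)
    where
    open ≡-Reasoning
    open +-*-Solver
    H : Config → ℕ
    H = height N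
    -- The two routes may end in different lists for the same set; the first clause of `Ranked`
    -- identifies their ranks.
    W≐W′ : W ≐ W′
    W≐W′ = ≗-trans W≗w (≗-sym W′≗w)
    drop : H u ≡ 2 + H v
    drop = height-drop (bounded-resp U≗u (in-box U U∈KD)) m 2 jump
    cover : Covers U V
    cover = jump-cover U V (in-box U U∈KD) (move-respˡ (≗-sym U≗u) (move-respʳ (≗-sym V≗v) m)) jump
              k<c (trans (U≗u _) pin)

-- Forbidden patterns

swap : ℕ → (ℕ → ℕ) → ℕ → ℕ
swap p ℓ r = if r ≡ᵇ p then ℓ (suc p) else (if r ≡ᵇ suc p then ℓ p else ℓ r)

swap-at : ∀ p ℓ → swap p ℓ p ≡ ℓ (suc p)
swap-at p ℓ rewrite dec-true (p ≟ p) refl = refl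

swap-suc : ∀ p ℓ → swap p ℓ (suc p) ≡ ℓ p
swap-suc p ℓ rewrite dec-false (suc p ≟ p) 1+n≢n | dec-true (p ≟ p) refl = refl

swap-off : ∀ p ℓ {r} → r ≢ p → r ≢ suc p → swap p ℓ r ≡ ℓ r
swap-off p ℓ {r} r≢p r≢1+p rewrite dec-false (r ≟ p) r≢p | dec-false (r ≟ suc p) r≢1+p = refl

young-cong : ∀ ℓ ℓ′ {r s} c → ℓ r ≡ ℓ′ s → young ℓ (r , c) ≡ young ℓ′ (s , c)
young-cong ℓ ℓ′ zero    e = refl
young-cong ℓ ℓ′ (suc c) e = cong (c <ᵇ_) e

young-≤ : ∀ ℓ {r s c} → c ≤ ℓ r → c ≤ ℓ s → young ℓ (r , c) ≡ young ℓ (s , c)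
young-≤ ℓ {c = zero}  _ _ = refl
young-≤ ℓ {c = suc c} p q = trans (young-in ℓ z<s p) (sym (young-in ℓ z<s q))

-- Row `p` is the shorter one, so dropping exactly the cells of row `suc p` beyond its end exchanges
-- the two lengths.
swap-path : ∀ p ℓ → 0 < p → ℓ p < ℓ (suc p) → UnitPath (young ℓ) (young (swap p ℓ))
swap-path p ℓ 0<p ascent = path-trans
  (lower-path p (ℓ p) (ℓ (suc p)) (young ℓ) 0<p
    (λ q → young-out ℓ (≤-<-trans (m≤n+m (ℓ (suc p)) (ℓ p)) q)) (λ q _ → young-out ℓ q))
  (done same)
  where
  same : lower p (ℓ p) (young ℓ) ≗ young (swap p ℓ)
  same (s , c) with s ≟ p | s ≟ suc p | c ≤? ℓ p
  ... | no s≢p | no s≢1+p | _ = trans (lower-off p (ℓ p) (young ℓ) c s≢p s≢1+p)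
    (young-cong ℓ (swap p ℓ) c (sym (swap-off p ℓ s≢p s≢1+p)))
  ... | yes refl | _ | yes c≤ = trans (lower-left p (young ℓ) p c≤)
    (trans (young-≤ ℓ c≤ (≤-trans c≤ (<⇒≤ ascent))) (young-cong ℓ (swap p ℓ) c (sym (swap-at p ℓ))))
  ... | yes refl | _ | no c≰ = trans (lower-to p (young ℓ) (≰⇒> c≰))
    (trans (cong (_∨ young ℓ (suc p , c)) (young-out ℓ (≰⇒> c≰))) (young-cong ℓ (swap p ℓ) c (sym (swap-at p ℓ))))
  ... | no _ | yes refl | yes c≤ = trans (lower-left p (young ℓ) (suc p) c≤)
    (trans (young-≤ ℓ (≤-trans c≤ (<⇒≤ ascent)) c≤) (young-cong ℓ (swap p ℓ) c (sym (swap-suc p ℓ))))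
  ... | no _ | yes refl | no c≰ = trans (lower-from p (young ℓ) (≰⇒> c≰))
    (sym (trans (young-cong (swap p ℓ) ℓ c (swap-suc p ℓ)) (young-out ℓ (≰⇒> c≰))))

bad-resp : ∀ {x y z x′ y′ z′} → x ≡ x′ → y ≡ y′ → z ≡ z′ →
           x < y × x < z × (suc x < y ⊎ suc x < z) → x′ < y′ × x′ < z′ × (suc x′ < y′ ⊎ suc x′ < z′)
bad-resp refl refl refl bad = bad

AdjacentBad : Config → Set
AdjacentBad f = ∃₂ λ ℓ i → UnitPath f (young ℓ) × 0 < i × Bad ℓ i (suc i) (2 + i)

-- The entry just before one of the two larger entries can take its role, or the two form an ascent
-- and are swapped.
make-adjacent : ∀ d e ℓ i {f} → UnitPath f (young ℓ) → 0 < i →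
                Bad ℓ i (suc (d + i)) (suc (e + suc (d + i))) → AdjacentBad f
make-adjacent zero zero ℓ i π 0<i bad = ℓ , i , π , 0<i , bad
make-adjacent d (suc e) ℓ i {f} π 0<i bad@(x<y , x<z , big) with ℓ (suc (e + suc (d + i))) <? ℓ (2 + (e + suc (d + i)))
... | yes ascent = make-adjacent d e (swap p ℓ) i (path-trans π (swap-path p ℓ z<s ascent)) 0<i
  (bad-resp (sym (swap-off p ℓ (<⇒≢ i<p) (<⇒≢ (m<n⇒m<1+n i<p))))
            (sym (swap-off p ℓ (<⇒≢ j<p) (<⇒≢ (m<n⇒m<1+n j<p))))
            (sym (swap-at p ℓ)) bad)
  where
  p : ℕ
  p = suc (e + suc (d + i))
  j<p : suc (d + i) < p
  j<p = s≤s (m≤n+m _ e)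
  i<p : i < p
  i<p = <-trans (s≤s (m≤n+m i d)) j<p
... | no no-ascent = make-adjacent d e ℓ i π 0<i (x<y , <-≤-trans x<z (≮⇒≥ no-ascent) , bigger big)
  where
  bigger : _ → _
  bigger (inj₁ q) = inj₁ q
  bigger (inj₂ q) = inj₂ (<-≤-trans q (≮⇒≥ no-ascent))
-- The two larger rows are adjacent here. Bringing the lower of them down by one opens one row
-- between them, hence the argument 1; the recursion descends lexicographically, on `d` before `e`.
make-adjacent (suc d) zero ℓ i {f} π 0<i bad@(x<y , x<z , big) with ℓ (suc (d + i)) <? ℓ (2 + (d + i))
... | yes ascent = make-adjacent d 1 (swap p ℓ) i (path-trans π (swap-path p ℓ z<s ascent)) 0<i
  (bad-resp (sym (swap-off p ℓ (<⇒≢ i<p) (<⇒≢ (m<n⇒m<1+n i<p))))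
            (sym (swap-at p ℓ))
            (sym (swap-off p ℓ (>⇒≢ (m<n⇒m<1+n ≤-refl)) 1+n≢n)) bad)
  where
  p : ℕ
  p = suc (d + i)
  i<p : i < p
  i<p = s≤s (m≤n+m i d)
... | no no-ascent = make-adjacent d 1 ℓ i π 0<i (<-≤-trans x<y (≮⇒≥ no-ascent) , x<z , bigger big)
  where
  bigger : _ → _
  bigger (inj₁ q) = inj₁ (<-≤-trans q (≮⇒≥ no-ascent))
  bigger (inj₂ q) = inj₂ q

-- The jump in three adjacent rows

module ThreeRows (ℓ : ℕ → ℕ) (i : ℕ) (0<i : 0 < i) (x<y : ℓ i < ℓ (suc i)) (x<z : ℓ i < ℓ (2 + i)) where

  k : ℕ
  k = suc (ℓ i)

  f : Config
  f = young ℓ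

  -- With `lo = ℓ i` this is the common end of the two routes to be compared. With `lo = k` one
  -- column less is lowered, which leaves column `k` for the jump.
  lowered : ℕ → Config
  lowered lo = lower (suc i) lo (lower i lo f)

  lowered-path : ∀ {lo} → ℓ i ≤ lo → UnitPath f (lowered lo)
  lowered-path {lo} x≤lo = path-trans
    (lower-path i lo (ℓ (suc i)) f 0<i
      (λ q → young-out ℓ (≤-<-trans (m≤n+m _ lo) q)) (λ q _ → young-out ℓ (≤-<-trans x≤lo q)))
    (lower-path (suc i) lo (ℓ (2 + i)) (lower i lo f) z<s
      (λ {c} q → trans (lower-off i lo f c (>⇒≢ (m<n⇒m<1+n ≤-refl)) 1+n≢n) (young-out ℓ (≤-<-trans (m≤n+m _ lo) q)))
      (λ q _ → lower-from i f q))

  jump : Config → Config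
  jump = slide (2 + i , k) (i , k)

  Agrees : Config → Set
  Agrees u = ∀ s {c} → c ≤ k → u (s , c) ≡ f (s , c)

  jump-move : ∀ {u} → Agrees u → (∀ {c} → k < c → u (2 + i , c) ≡ false) → Move u (jump u)
  jump-move {u} agrees end = record
    { top = 2 + i ; bot = i ; col = k ; 0<bot = 0<i ; bot<top = m<n⇒m<1+n ≤-refl
    ; occupied = trans (agrees (2 + i) ≤-refl) (young-in ℓ z<s x<z)
    ; rightmost = end
    ; vacant = trans (agrees i ≤-refl) (young-out ℓ ≤-refl)
    ; full = λ i<s s<2+i → trans (agrees _ ≤-refl) (middle (≤-antisym (s≤s⁻¹ s<2+i) i<s))
    ; effect = λ _ → refl }
    where
    middle : ∀ {s} → s ≡ suc i → f (s , k) ≡ true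
    middle refl = young-in ℓ z<s x<y

  -- In column `k` the jump from the third row to the first occupies the same positions as two
  -- successive unit drops: rows `i` and `suc i` are filled and row `2 + i` is emptied.
  jump-lowered : ∀ {u} → Agrees u → ∀ s {c} → c ≤ k → jump u (s , c) ≡ lowered (ℓ i) (s , c)
  jump-lowered {u} agrees s {c} c≤k with m≤n⇒m<n∨m≡n c≤k
  ... | inj₁ c<k = trans (slide-other u {s , c} (column≢ (<⇒≢ c<k)) (column≢ (<⇒≢ c<k)))
    (trans (agrees s c≤k) (sym (trans (lower-left (suc i) (lower i (ℓ i) f) s (s≤s⁻¹ c<k)) (lower-left i f s (s≤s⁻¹ c<k)))))
  ... | inj₂ refl with s ≟ i | s ≟ suc i | s ≟ 2 + i
  ... | yes refl | _ | _ = trans (slide-target (2 + i , k) (i , k) u)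
    (sym (trans (lower-off (suc i) (ℓ i) (lower i (ℓ i) f) k (<⇒≢ ≤-refl) (<⇒≢ (m<n⇒m<1+n ≤-refl)))
      (trans (lower-to i f {k} ≤-refl) (∨-trueʳ {f (i , k)} (young-in ℓ z<s x<y)))))
  ... | no s≢i | yes refl | _ = trans (slide-other {2 + i , k} {i , k} u {suc i , k} (row≢ {suc i} {2 + i} {k} {k} (<⇒≢ ≤-refl)) (row≢ {suc i} {i} {k} {k} 1+n≢n))
    (trans (agrees (suc i) ≤-refl) (trans (young-in ℓ z<s x<y) (sym
      (trans (lower-to (suc i) (lower i (ℓ i) f) {k} ≤-refl) (∨-trueʳ {lower i (ℓ i) f (suc i , k)}
        (trans (lower-off i (ℓ i) f k (>⇒≢ (m<n⇒m<1+n ≤-refl)) 1+n≢n) (young-in ℓ z<s x<z)))))))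
  ... | no s≢i | no _ | yes refl = trans (slide-source {2 + i , k} {i , k} u (row≢ s≢i))
    (sym (lower-from (suc i) (lower i (ℓ i) f) {k} ≤-refl))
  ... | no s≢i | no s≢1+i | no s≢2+i = trans (slide-other {2 + i , k} {i , k} u {s , k} (row≢ s≢2+i) (row≢ s≢i))
    (trans (agrees s ≤-refl) (sym (trans (lower-off (suc i) (ℓ i) (lower i (ℓ i) f) k s≢1+i s≢2+i)
      (lower-off i (ℓ i) f k s≢i s≢1+i))))

  jump-off : ∀ u s {c} → k < c → jump u (s , c) ≡ u (s , c)
  jump-off u s {c} k<c = slide-other u {s , c} (column≢ (>⇒≢ k<c)) (column≢ (>⇒≢ k<c))

  module _ (D₀ : Diagram) (ranked : Ranked D₀) (start : Reach ⟦ D₀ ⟧ f) where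
    open RankFunction D₀ ranked

    -- Everything beyond column `k` is lowered first, which makes the cell of row `2 + i` in column
    -- `k` rightmost. The pin in the middle row is the cell that came down from row `2 + i` in
    -- column `suc k`.
    z-long : k < ℓ (2 + i) → ⊥
    z-long k<z = no-bypass start (lowered-path (n≤1+n (ℓ i))) (done same) (lowered-path ≤-refl)
      (jump-move agrees (lower-from (suc i) (lower i k f))) refl ≤-refl pin
      where
      agrees : Agrees (lowered k)
      agrees s c≤k = trans (lower-left (suc i) (lower i k f) s c≤k) (lower-left i f s c≤k)

      pin : lowered k (suc i , suc k) ≡ true
      pin = trans (lower-to (suc i) (lower i k f) {suc k} ≤-refl) (∨-trueʳ {lower i k f (suc i , suc k)}
        (trans (lower-off i k f (suc k) (>⇒≢ (m<n⇒m<1+n ≤-refl)) 1+n≢n) (young-in ℓ z<s k<z)))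

      same : jump (lowered k) ≗ lowered (ℓ i)
      same (s , c) with c ≤? k
      ... | yes c≤k = jump-lowered agrees s c≤k
      ... | no c≰k  = trans (jump-off (lowered k) s (≰⇒> c≰k))
        (lower-agree (suc i) (lower i k f) (lower i (ℓ i) f) s (≰⇒> c≰k) (<⇒≤ (≰⇒> c≰k)) λ s′ →
          lower-agree i f f s′ (≰⇒> c≰k) (<⇒≤ (≰⇒> c≰k)) λ _ → refl)

    -- The third row already ends at column `k`, so the jump comes first, pinned by the middle row's
    -- own cell in column `suc k`; the rest of the middle row is lowered afterwards.
    y-long : ℓ (2 + i) ≡ k → k < ℓ (suc i) → ⊥
    y-long z≡k k<y = no-bypass start (done λ _ → refl) path (lowered-path ≤-refl)
      (jump-move (λ _ _ → refl) z-end) refl ≤-refl (young-in ℓ z<s k<y)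
      where
      z-end : ∀ {c} → k < c → f (2 + i , c) ≡ false
      z-end {c} k<c = young-out ℓ (subst (_< c) (sym z≡k) k<c)

      same : lower i k (jump f) ≗ lowered (ℓ i)
      same (s , c) with c ≤? k
      ... | yes c≤k = trans (lower-left i (jump f) s c≤k) (jump-lowered (λ _ _ → refl) s c≤k)
      ... | no c≰k  = trans
        (lower-agree i (jump f) f s (≰⇒> c≰k) (<⇒≤ (≰⇒> c≰k)) λ s′ → jump-off f s′ (≰⇒> c≰k))
        (sym (lower-vacant (suc i) (ℓ i) (lower i (ℓ i) f) s c
          (trans (lower-off i (ℓ i) f c (>⇒≢ (m<n⇒m<1+n ≤-refl)) 1+n≢n) (z-end (≰⇒> c≰k)))))

      path : UnitPath (jump f) (lowered (ℓ i))
      path = path-trans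
        (lower-path i k (ℓ (suc i)) (jump f) 0<i
          (λ q → trans (jump-off f (suc i) (≤-<-trans (m≤m+n k _) q)) (young-out ℓ (≤-<-trans (m≤n+m _ k) q)))
          (λ q _ → trans (jump-off f i q) (young-out ℓ (<⇒≤ q))))
        (done same)

-- From ranked posets to pure compositions

<⇒+ : ∀ {m n} → m < n → ∃ λ d → n ≡ suc (d + m)
<⇒+ {m} {n} m<n = n ∸ suc m , trans (sym (m∸n+n≡m m<n)) (+-suc (n ∸ suc m) m)

ranked⇒pureShape : ∀ a → Ranked (keyDiagram a) → PureShape (shape a)
ranked⇒pureShape a ranked {i} 0<i i<j j<k bad with <⇒+ i<j
... | d , refl with <⇒+ j<k
... | e , refl with make-adjacent d e (shape a) i (done (key≗young a)) 0<i bad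
... | ℓ , i′ , π , 0<i′ , x<y , x<z , big = by-length (m≤n⇒m<n∨m≡n x<z) big
  where
  open ThreeRows ℓ i′ 0<i′ x<y x<z
  -- A third row beyond column `k` is treated first. Otherwise it ends exactly at `k`, and `big`
  -- makes the middle row the long one.
  by-length : k < ℓ (2 + i′) ⊎ k ≡ ℓ (2 + i′) → k < ℓ (suc i′) ⊎ k < ℓ (2 + i′) → ⊥
  by-length (inj₁ k<z) _          = z-long (keyDiagram a) ranked (forget π) k<z
  by-length (inj₂ k≡z) (inj₁ k<y) = y-long (keyDiagram a) ranked (forget π) (sym k≡z) k<y
  by-length (inj₂ k≡z) (inj₂ k<z) = contradiction k≡z (<⇒≢ k<z)

theorem6p5 : (a : WeakComp) → Ranked (keyDiagram a) ⇔ Pure a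
theorem6p5 a = mk⇔ (pureShape⇒pure a ∘ ranked⇒pureShape a) (pure⇒ranked a)
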